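{- For $m,n\geq2$ and $j\geq1$, the number of Fibonacci polyominoes $P\in\mathcal F_{m,n}$ with $\operatorname{lmin}(P)=j$ equals \[ B(m,j)\binom{n-2}{m-1}+B(m-1,j-1)\binom{n-2}{m-2}. \] For $m=1$, the unique polyomino in $\mathcal F_{1,n}$ has one left-to-right minimum.
   Context: A Fibonacci polyomino is a (nonempty) polyomino, considered up to translation, that is column-convex (each column is a contiguous segment of unit cells) and such that, reading columns from left to right, the bottom cell of each column lies exactly one unit above the bottom cell of the preceding column. Equivalently, it is given by a sequence of column heights $(h_1,\dots,h_m)$, $m\ge 1$, with $h_i\ge 2$ for $1\le i\le m-1$ and $h_m\ge 1$; column $i$ consists of the cells in column position $i$ and rows $i,i+1,\dots,i+h_i-1$. The horizontal (resp. vertical) semiperimeter is half the number of horizontal (resp. vertical) unit edges on the boundary (edges belonging to exactly one cell). $\mathcal F_{m,n}$ is the set of Fibonacci polyominoes with horizontal semiperimeter $m$ (equivalently $m$ columns) and vertical semiperimeter $n$. For $P$ with column heights $(h_1,\ldots,h_m)$, $\operatorname{lmin}(P)$ is the number of left-to-right minima, i.e. of columns $i$ such that $i=1$ or $h_i<\min\{h_1,\ldots,h_{i-1}\}$. $B(\ell,j)=\frac{j}{2\ell-j}\binom{2\ell-j}{\ell}$ for $1\le j\le\ell$ (the number of Dyck paths of semilength $\ell$ with exactly $j$ returns to the axis), $B(0,0)=1$, and $B(\ell,j)=0$ otherwise. Binomial coefficients $\binom ab$ with $a\ge0$ vanish if $b<0$ or $b>a$. -}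

module Defs where

open import Data.Bool using (if_then_else_)
open import Data.List using (List; []; _∷_; _++_; map; concatMap; filter; length; upTo)
open import Data.Nat using (ℕ; zero; suc; _+_; _*_; _∸_; _/_; _≤_; _≤?_; _<ᵇ_; _⊓_; _≟_; z≤n; s≤s; NonZero; >-nonZero)
open import Data.Nat.Combinatorics using (_C_; nCk+nC[k+1]≡[n+1]C[k+1])
open import Data.Nat.Divisibility using (_∣_; divides; ∣m+n∣m⇒∣n)
open import Data.Nat.DivMod using (m/n*n≡m)
open import Data.Nat.Properties using (m<n⇒0<n∸m; m≤m+n; ≤-trans; *-comm; *-assoc; *-distribʳ-+; m∸n+n≡m; *-zeroʳ)
open import Data.Nat.Tactic.RingSolver using (solve-∀)
open import Data.Product using (Σ; Σ-syntax; _×_; _,_; proj₁)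
open import Data.Product.Properties using (≡-dec)
open import Data.List.Membership.DecPropositional (≡-dec _≟_ _≟_) using (_∈?_)
open import Relation.Nullary using (yes; no; contradiction)
open import Relation.Binary.PropositionalEquality using (_≡_; refl; sym; cong; cong₂; subst; module ≡-Reasoning)

data IsHeightSequence : List ℕ → Set where
  final : ∀ {h} → 1 ≤ h → IsHeightSequence (h ∷ [])
  _∷_   : ∀ {h h′ hs} → 2 ≤ h → IsHeightSequence (h′ ∷ hs) → IsHeightSequence (h ∷ h′ ∷ hs)

-- Each translation class is represented by the member whose lowest cell of
-- the first column is (1 , 1).
FibonacciPolyomino : Set
FibonacciPolyomino = Σ (List ℕ) IsHeightSequence

heights : FibonacciPolyomino → List ℕ
heights = proj₁

-- (column , row)
Cell : Set
Cell = ℕ × ℕ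

columnsFrom : ℕ → List ℕ → List Cell
columnsFrom i []       = []
columnsFrom i (h ∷ hs) = map (λ k → i , i + k) (upTo h) ++ columnsFrom (suc i) hs

cells : FibonacciPolyomino → List Cell
cells P = columnsFrom 1 (heights P)

-- A vertical unit edge is named by the cell whose left side it is, a
-- horizontal one by the cell whose bottom side it is.
Edge : Set
Edge = ℕ × ℕ

verticalEdges horizontalEdges : Cell → List Edge
verticalEdges   (x , y) = (x , y) ∷ (suc x , y) ∷ []
horizontalEdges (x , y) = (x , y) ∷ (x , suc y) ∷ []

-- An edge shared by several cells occurs several times in
-- `concatMap edges cs`, but an edge belonging to exactly one cell occurs
-- there once, so the resulting list has no repetitions.
boundary : (Cell → List Edge) → List Cell → List Edge
boundary edges cs =
  filter (λ e → length (filter (λ c → e ∈? edges c) cs) ≟ 1) (concatMap edges cs)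

HorizontalSemiperimeter VerticalSemiperimeter : FibonacciPolyomino → ℕ → Set
HorizontalSemiperimeter P m = length (boundary horizontalEdges (cells P)) ≡ 2 * m
VerticalSemiperimeter   P n = length (boundary verticalEdges   (cells P)) ≡ 2 * n

-- All components other than the height list are propositions, so elements
-- are equal as soon as their height lists are.
𝓕 : ℕ → ℕ → Set
𝓕 m n = Σ[ P ∈ FibonacciPolyomino ] HorizontalSemiperimeter P m × VerticalSemiperimeter P n

-- μ is the minimum of the heights already read.
lminFrom : ℕ → List ℕ → ℕ
lminFrom μ []       = 0
lminFrom μ (h ∷ hs) = (if h <ᵇ μ then 1 else 0) + lminFrom (μ ⊓ h) hs

lminHeights : List ℕ → ℕ
lminHeights []       = 0
lminHeights (h ∷ hs) = suc (lminFrom h hs)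

lmin : FibonacciPolyomino → ℕ
lmin P = lminHeights (heights P)

2ℓ∸j-nonZero : ∀ {ℓ j} → 1 ≤ j → j ≤ ℓ → NonZero (2 * ℓ ∸ j)
2ℓ∸j-nonZero {suc l} {j} 1≤j j≤ℓ =
  >-nonZero (m<n⇒0<n∸m (≤-trans (s≤s j≤ℓ) (subst (suc (suc l) ≤_) (eq l) (m≤m+n (suc (suc l)) l))))
  where
  eq : ∀ l → suc (suc l) + l ≡ 2 * suc l
  eq = solve-∀
2ℓ∸j-nonZero {zero} {suc j} 1≤j ()

-- The division is exact, see B-exact.
B : ℕ → ℕ → ℕ
B zero      zero      = 1
B zero      (suc _)   = 0
B (suc _)   zero      = 0
B ℓ@(suc _) j@(suc _) with j ≤? ℓ
... | yes j≤ℓ = _/_ (j * ((2 * ℓ ∸ j) C ℓ)) (2 * ℓ ∸ j) {{2ℓ∸j-nonZero {ℓ} {j} (s≤s z≤n) j≤ℓ}}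
... | no  _   = 0

C-absorb : ∀ n k → suc k * (suc n C suc k) ≡ suc n * (n C k)
C-absorb zero    zero    = refl
C-absorb zero    (suc k) = *-zeroʳ (suc (suc k))
C-absorb (suc n) zero    = begin
  1 * (suc (suc n) C 1)                ≡⟨ cong (1 *_) (sym (nCk+nC[k+1]≡[n+1]C[k+1] (suc n) 0)) ⟩
  1 * (1 + (suc n C 1))                ≡⟨ e (suc n C 1) ⟩
  1 + 1 * (suc n C 1)                  ≡⟨ cong suc (C-absorb n 0) ⟩
  1 + suc n * 1                        ∎
  where
  open ≡-Reasoning
  e : ∀ a → 1 * (1 + a) ≡ 1 + 1 * a
  e = solve-∀
C-absorb (suc n) (suc k) = begin
  suc (suc k) * (suc (suc n) C suc (suc k))                          ≡⟨ cong (suc (suc k) *_) (sym (nCk+nC[k+1]≡[n+1]C[k+1] (suc n) (suc k))) ⟩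
  suc (suc k) * ((suc n C suc k) + (suc n C suc (suc k)))            ≡⟨ e k (suc n C suc k) (suc n C suc (suc k)) ⟩
  (suc n C suc k) + (suc k * (suc n C suc k) + suc (suc k) * (suc n C suc (suc k)))
    ≡⟨ cong ((suc n C suc k) +_) (cong₂ _+_ (C-absorb n k) (C-absorb n (suc k))) ⟩
  (suc n C suc k) + (suc n * (n C k) + suc n * (n C suc k))          ≡⟨ f n (suc n C suc k) (n C k) (n C suc k) ⟩
  (suc n C suc k) + suc n * ((n C k) + (n C suc k))                  ≡⟨ cong (λ x → (suc n C suc k) + suc n * x) (nCk+nC[k+1]≡[n+1]C[k+1] n k) ⟩
  suc (suc n) * (suc n C suc k)                                      ∎
  where
  open ≡-Reasoning
  e : ∀ k a b → suc (suc k) * (a + b) ≡ a + (suc k * a + suc (suc k) * b)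
  e = solve-∀
  f : ∀ n a b c → a + (suc n * b + suc n * c) ≡ a + suc n * (b + c)
  f = solve-∀

C-divides : ∀ a k j → a + j ≡ 2 * k → a ∣ j * (a C k)
C-divides zero    zero    zero    eq = divides 0 refl
C-divides zero    (suc k) j       eq = divides 0 (*-zeroʳ j)
C-divides (suc a) (suc k) j       eq = ∣m+n∣m⇒∣n (divides (2 * (a C k)) sum≡) (divides (suc a C suc k) (*-comm (suc a) (suc a C suc k)))
  where
  open ≡-Reasoning
  r : ∀ x y → 2 * (x * y) ≡ 2 * y * x
  r = solve-∀
  sum≡ : suc a * (suc a C suc k) + j * (suc a C suc k) ≡ 2 * (a C k) * suc a
  sum≡ = begin
    suc a * (suc a C suc k) + j * (suc a C suc k)  ≡⟨ sym (*-distribʳ-+ (suc a C suc k) (suc a) j) ⟩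
    (suc a + j) * (suc a C suc k)                  ≡⟨ cong (_* (suc a C suc k)) eq ⟩
    2 * suc k * (suc a C suc k)                    ≡⟨ *-assoc 2 (suc k) (suc a C suc k) ⟩
    2 * (suc k * (suc a C suc k))                  ≡⟨ cong (2 *_) (C-absorb a k) ⟩
    2 * (suc a * (a C k))                          ≡⟨ r (suc a) (a C k) ⟩
    2 * (a C k) * suc a                            ∎

B-exact : ∀ ℓ j → 1 ≤ j → j ≤ ℓ → B ℓ j * (2 * ℓ ∸ j) ≡ j * ((2 * ℓ ∸ j) C ℓ)
B-exact ℓ@(suc l) j@(suc _) 1≤j j≤ℓ with j ≤? ℓ
... | no  j≰ℓ  = contradiction j≤ℓ j≰ℓ
... | yes j≤ℓ′ = m/n*n≡m {{2ℓ∸j-nonZero {ℓ} {j} (s≤s z≤n) j≤ℓ′}}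
  (C-divides (2 * ℓ ∸ j) ℓ j (m∸n+n≡m (≤-trans j≤ℓ (m≤m+n ℓ (ℓ + 0)))))

{-# OPTIONS --safe #-}
-- Split a column sequence at its left-to-right minima.  The columns between two
-- successive minima are again such a sequence, measured from the first of the
-- two, so that the polyomino becomes a plane forest with one node per column and
-- one root per minimum, each node labelled by a positive gap.  Subtracting 2 from
-- all heights (a final column of height 1 is a minimum of its own and is dropped,
-- which gives the second summand), the vertical semiperimeter is one more than
-- the sum of the labels.  Forests of m nodes and j roots satisfy the recurrence
-- of B(m,j), which comes from V = t + V² for the generating function V of trees,
-- and the labels are independent of the shape: C(n-2,m-1) compositions of n-1.
module Submission where

open import Defs
open import Data.Bool using (true; false; if_then_else_; T)
open import Data.Empty using (⊥-elim)
open import Data.Fin using (Fin; zero)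
open import Data.Fin.Properties using (+↔⊎)
open import Data.List using (List; []; _∷_; _++_; length; map; filter; concatMap; upTo; applyUpTo)
open import Data.List.Membership.Propositional using (_∈_)
open import Data.List.Properties using (++-identityʳ; ++-assoc; ++-cancelʳ; length-++; length-map; map-injective; map-applyUpTo; concatMap-++; filter-++; ∷-injective)
open import Data.List.Relation.Unary.All using (All; []; _∷_)
open import Data.List.Relation.Unary.Any using (here; there)
open import Data.Nat using (ℕ; zero; suc; _+_; _*_; _∸_; _≤_; _<_; _≤?_; _<?_; _≟_; _<ᵇ_; z≤n; s≤s)
open import Data.Nat.Combinatorics using (_C_; nCk+nC[k+1]≡[n+1]C[k+1]; k>n⇒nCk≡0; nCk≡nC[n∸k])
open import Data.Nat.Properties
open import Data.Nat.Tactic.RingSolver using (solve-∀)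
open import Data.Product using (Σ; Σ-syntax; ∃-syntax; _×_; _,_; proj₁; proj₂)
open import Data.Product.Properties using (≡-dec)
open import Data.List.Membership.DecPropositional (≡-dec _≟_ _≟_) using (_∈?_)
open import Data.Sum using (_⊎_; inj₁; inj₂)
open import Data.Sum.Function.Propositional using (_⊎-↔_)
open import Algebra.Properties.CommutativeSemigroup +-commutativeSemigroup using () renaming (interchange to +-interchange)
open import Function using (_∘_; id)
open import Function.Bundles using (_↔_; _⇔_; mk↔ₛ′; mk⇔)
open import Function.Construct.Composition using (_↔-∘_)
open import Function.Construct.Symmetry using (↔-sym)
open import Relation.Binary.PropositionalEquality
open import Relation.Nullary using (Dec; Irrelevant; does; ¬_; yes; no; contradiction)
open import Relation.Nullary.Decidable using (dec-true; dec-false; does-⇔; _⊎-dec_)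
open import Relation.Unary using (Decidable)

-- The ballot recurrence

B-vanish : ∀ {ℓ j} → ℓ < j → B ℓ j ≡ 0
B-vanish {zero}  {suc j} _   = refl
B-vanish {suc ℓ} {suc j} ℓ<j with suc j ≤? suc ℓ
... | yes j≤ℓ = contradiction ℓ<j (≤⇒≯ j≤ℓ)
... | no  _   = refl

-- Companion of `C-absorb` that keeps the lower index. Adding `suc k * (suc (suc a) C suc k)` to
-- both sides turns the left one, by absorption and Pascal's rule, into a multiple by `suc (suc a)`,
-- which splits as `suc k + suc d`.
absorb-complement : ∀ a k d → k + d ≡ a → suc a * (a C k) ≡ suc d * (suc a C k)
absorb-complement a zero    d refl = refl
absorb-complement (suc a) (suc k) d eq = +-cancelˡ-≡ (suc k * (suc (suc a) C suc k)) _ _ (begin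
  suc k * (suc (suc a) C suc k) + suc (suc a) * (suc a C suc k)
    ≡⟨ cong (_+ suc (suc a) * (suc a C suc k)) (C-absorb (suc a) k) ⟩
  suc (suc a) * (suc a C k) + suc (suc a) * (suc a C suc k)
    ≡⟨ *-distribˡ-+ (suc (suc a)) (suc a C k) (suc a C suc k) ⟨
  suc (suc a) * ((suc a C k) + (suc a C suc k))
    ≡⟨ cong₂ _*_ (cong suc (sym eq)) (nCk+nC[k+1]≡[n+1]C[k+1] (suc a) k) ⟩
  suc (suc k + d) * (suc (suc a) C suc k)
    ≡⟨ cong (_* (suc (suc a) C suc k)) (sym (+-suc (suc k) d)) ⟩
  (suc k + suc d) * (suc (suc a) C suc k)
    ≡⟨ *-distribʳ-+ (suc (suc a) C suc k) (suc k) (suc d) ⟩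
  suc k * (suc (suc a) C suc k) + suc d * (suc (suc a) C suc k) ∎)
  where open ≡-Reasoning

-- B(ℓ,j) = C(2ℓ-j-1, ℓ-1) - C(2ℓ-j-1, ℓ), with ℓ and j shifted by one.
B-ballot : ∀ ℓ j x → x + j ≡ 2 * ℓ → B (suc ℓ) (suc j) + (x C suc ℓ) ≡ x C ℓ
B-ballot ℓ j x x+j≡2ℓ with ≤-<-connex j ℓ
... | inj₂ ℓ<j = trans (cong₂ _+_ (B-vanish (s≤s ℓ<j)) (k>n⇒nCk≡0 (m<n⇒m<1+n x<ℓ))) (sym (k>n⇒nCk≡0 x<ℓ))
  where
  x<ℓ : x < ℓ
  x<ℓ = +-cancelʳ-< ℓ x ℓ (begin-strict
    x + ℓ        <⟨ +-monoʳ-< x ℓ<j ⟩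
    x + j        ≡⟨ x+j≡2ℓ ⟩
    ℓ + (ℓ + 0)  ≡⟨ cong (ℓ +_) (+-identityʳ ℓ) ⟩
    ℓ + ℓ        ∎)
    where open ≤-Reasoning
-- Here `suc x` is the denominator in `B (suc ℓ) (suc j)`. After multiplication by it both terms are
-- multiples of `suc x C suc ℓ`, with coefficients adding up to `suc ℓ`.
... | inj₁ j≤ℓ = *-cancelʳ-≡ _ _ (suc x) (begin
  (B (suc ℓ) (suc j) + (x C suc ℓ)) * suc x
    ≡⟨ *-distribʳ-+ (suc x) (B (suc ℓ) (suc j)) (x C suc ℓ) ⟩
  B (suc ℓ) (suc j) * suc x + (x C suc ℓ) * suc x
    ≡⟨ cong₂ _+_ exact (trans (*-comm (x C suc ℓ) (suc x)) (complement (ℓ ∸ j) ℓ+d≡x)) ⟩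
  suc j * (suc x C suc ℓ) + (ℓ ∸ j) * (suc x C suc ℓ)
    ≡⟨ *-distribʳ-+ (suc x C suc ℓ) (suc j) (ℓ ∸ j) ⟨
  suc (j + (ℓ ∸ j)) * (suc x C suc ℓ)
    ≡⟨ cong (λ y → suc y * (suc x C suc ℓ)) (m+[n∸m]≡n j≤ℓ) ⟩
  suc ℓ * (suc x C suc ℓ)
    ≡⟨ C-absorb x ℓ ⟩
  suc x * (x C ℓ)
    ≡⟨ *-comm (suc x) _ ⟩
  (x C ℓ) * suc x ∎)
  where
  open ≡-Reasoning
  ℓ+d≡x : ℓ + (ℓ ∸ j) ≡ x
  ℓ+d≡x = +-cancelʳ-≡ j _ _ (begin
    ℓ + (ℓ ∸ j) + j    ≡⟨ +-assoc ℓ (ℓ ∸ j) j ⟩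
    ℓ + (ℓ ∸ j + j)    ≡⟨ cong (ℓ +_) (trans (m∸n+n≡m j≤ℓ) (sym (+-identityʳ ℓ))) ⟩
    2 * ℓ              ≡⟨ x+j≡2ℓ ⟨
    x + j              ∎)
  denominator : 2 * suc ℓ ∸ suc j ≡ suc x
  denominator = begin
    2 * suc ℓ ∸ suc j      ≡⟨ cong (_∸ suc j) (*-suc 2 ℓ) ⟩
    suc (2 * ℓ) ∸ j        ≡⟨ cong (λ y → suc y ∸ j) x+j≡2ℓ ⟨
    suc x + j ∸ j          ≡⟨ m+n∸n≡m (suc x) j ⟩
    suc x                  ∎
  exact : B (suc ℓ) (suc j) * suc x ≡ suc j * (suc x C suc ℓ)
  exact = subst (λ y → B (suc ℓ) (suc j) * y ≡ suc j * (y C suc ℓ)) denominator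
            (B-exact (suc ℓ) (suc j) (s≤s z≤n) (s≤s j≤ℓ))
  complement : ∀ d → ℓ + d ≡ x → suc x * (x C suc ℓ) ≡ d * (suc x C suc ℓ)
  complement zero    eq = trans (cong (suc x *_) (k>n⇒nCk≡0 (s≤s (≤-reflexive (trans (sym eq) (+-identityʳ ℓ))))))
                                (*-zeroʳ (suc x))
  complement (suc d) eq = absorb-complement x (suc ℓ) d (trans (sym (+-suc ℓ d)) eq)

-- Each `b` is a difference of neighbouring binomials, written additively to avoid truncated
-- subtraction; Pascal's rule for both binomials passes to the difference.
difference-pascal : ∀ x k {b₁ b₂ b₃} →
  b₁ + (suc x C suc (suc k)) ≡ suc x C suc k →
  b₂ + (x C suc k) ≡ x C k →
  b₃ + (x C suc (suc k)) ≡ x C suc k →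
  b₁ ≡ b₂ + b₃
difference-pascal x k {b₁} {b₂} {b₃} eq₁ eq₂ eq₃ = +-cancelʳ-≡ (suc x C suc (suc k)) _ _ (begin
  b₁ + (suc x C suc (suc k))                        ≡⟨ eq₁ ⟩
  suc x C suc k                                     ≡⟨ nCk+nC[k+1]≡[n+1]C[k+1] x k ⟨
  (x C k) + (x C suc k)                             ≡⟨ cong₂ _+_ eq₂ eq₃ ⟨
  (b₂ + (x C suc k)) + (b₃ + (x C suc (suc k)))     ≡⟨ +-interchange b₂ (x C suc k) b₃ (x C suc (suc k)) ⟩
  (b₂ + b₃) + ((x C suc k) + (x C suc (suc k)))     ≡⟨ cong ((b₂ + b₃) +_) (nCk+nC[k+1]≡[n+1]C[k+1] x (suc k)) ⟩
  (b₂ + b₃) + (suc x C suc (suc k))                 ∎)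
  where open ≡-Reasoning

-- The central binomials of an odd row agree by symmetry. This serves as the ballot difference for
-- `B (suc m) 0`, which is zero.
C-middle : ∀ d → (d + suc d) C suc d ≡ (d + suc d) C d
C-middle d = trans (nCk≡nC[n∸k] (m≤n+m (suc d) d)) (cong ((d + suc d) C_) (m+n∸n≡m d (suc d)))

-- As ballot differences the three values lie in adjacent rows of Pascal's triangle, so
-- `difference-pascal` applies. The summands match those of `forests-split`.
B-recurrence : ∀ m j → B (suc m) (suc j) ≡ B m j + B (suc m) (suc (suc j))
B-recurrence m j with ≤-<-connex j m
... | inj₂ m<j = trans (B-vanish (s≤s m<j))
                   (sym (cong₂ _+_ (B-vanish m<j) (B-vanish (s≤s (m<n⇒m<1+n m<j)))))
B-recurrence zero    zero    | inj₁ _ = refl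
B-recurrence (suc m) zero    | inj₁ _ =
  difference-pascal (m + suc m) m
    (B-ballot (suc m) 0 (suc (m + suc m)) (double m))
    (C-middle m)
    (B-ballot (suc m) 1 (m + suc m) (double′ m))
  where
  double : ∀ m → suc (m + suc m) + 0 ≡ 2 * suc m
  double = solve-∀
  double′ : ∀ m → m + suc m + 1 ≡ 2 * suc m
  double′ = solve-∀
B-recurrence (suc m) (suc i) | inj₁ (s≤s i≤m) =
  difference-pascal x m
    (B-ballot (suc m) (suc i) (suc x) (trans (cong suc (+-suc x i)) sum≡))
    (B-ballot m i x x+i≡2m)
    (B-ballot (suc m) (suc (suc i)) x (trans (+-suc x (suc i)) (trans (cong suc (+-suc x i)) sum≡)))
  where
  x = 2 * m ∸ i
  x+i≡2m : x + i ≡ 2 * m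
  x+i≡2m = m∸n+n≡m (≤-trans i≤m (m≤m+n m (m + 0)))
  sum≡ : suc (suc (x + i)) ≡ 2 * suc m
  sum≡ = trans (cong (suc ∘ suc) x+i≡2m) (sym (*-suc 2 m))

-- Labelled plane forests

-- A node stores its positive label minus one, so that every `g` is admissible.
data Forest : Set where
  nil  : Forest
  cons : (g : ℕ) (children siblings : Forest) → Forest

size weight roots : Forest → ℕ
size nil           = 0
size (cons g c s)  = suc (size c + size s)
weight nil          = 0
weight (cons g c s) = suc g + (weight c + weight s)
roots nil          = 0
roots (cons g c s) = suc (roots s)

Forests : ℕ → ℕ → ℕ → Set
Forests m w j = Σ[ f ∈ Forest ] size f ≡ m × weight f ≡ w × roots f ≡ j

-- What is left of a forest whose first root is a leaf: the label of that leaf and the remaining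
-- forest.
Planted : ℕ → ℕ → ℕ → Set
Planted m w j = Σ[ (g , f) ∈ ℕ × Forest ] size f ≡ m × suc g + weight f ≡ w × roots f ≡ j

subset-≡ : ∀ {A : Set} {P : A → Set} → (∀ {x} → Irrelevant (P x)) →
           {p q : Σ A P} → proj₁ p ≡ proj₁ q → p ≡ q
subset-≡ irr {x , a} {.x , b} refl = cong (x ,_) (irr a b)

×-irrelevant : ∀ {A B : Set} → Irrelevant A → Irrelevant B → Irrelevant (A × B)
×-irrelevant irrA irrB (a , b) (a′ , b′) = cong₂ _,_ (irrA a a′) (irrB b b′)

3≡-irrelevant : ∀ {a b c d e f : ℕ} → Irrelevant (a ≡ b × c ≡ d × e ≡ f)
3≡-irrelevant = ×-irrelevant ≡-irrelevant (×-irrelevant ≡-irrelevant ≡-irrelevant)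

roots≤size : ∀ f → roots f ≤ size f
roots≤size nil          = z≤n
roots≤size (cons g c s) = s≤s (≤-trans (roots≤size s) (m≤n+m (size s) (size c)))

empty↔Fin : ∀ {A : Set} {n} → n ≡ 0 → ¬ A → A ↔ Fin n
empty↔Fin refl ¬a = mk↔ₛ′ (⊥-elim ∘ ¬a) (λ ()) (λ ()) (λ a → ⊥-elim (¬a a))

-- V = t + V²: the first root is a leaf, or else it is moved behind its first
-- child, which becomes a root while its siblings stay below.
forests-split : ∀ {m w j} → Forests (suc m) w (suc j) ↔ (Planted m w j ⊎ Forests (suc m) w (suc (suc j)))
forests-split {m} {w} {j} = mk↔ₛ′ to from to-from from-to
  where
  size-eq : ∀ a b c → suc (a + suc (b + c)) ≡ suc (suc (a + b) + c)
  size-eq = solve-∀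
  weight-eq : ∀ g h a b c → suc h + (a + (suc g + (b + c))) ≡ suc g + (suc h + (a + b) + c)
  weight-eq = solve-∀
  to : Forests (suc m) w (suc j) → Planted m w j ⊎ Forests (suc m) w (suc (suc j))
  to (cons g nil s , sz , wt , rt) = inj₁ ((g , s) , suc-injective sz , wt , suc-injective rt)
  to (cons g (cons h c r) s , sz , wt , rt) =
    inj₂ (cons h c (cons g r s) , trans (size-eq (size c) (size r) (size s)) sz ,
          trans (weight-eq g h (weight c) (weight r) (weight s)) wt , cong suc rt)
  from : Planted m w j ⊎ Forests (suc m) w (suc (suc j)) → Forests (suc m) w (suc j)
  from (inj₁ ((g , s) , sz , wt , rt)) = cons g nil s , cong suc sz , wt , cong suc rt
  from (inj₂ (cons h c (cons g r s) , sz , wt , rt)) =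
    cons g (cons h c r) s , trans (sym (size-eq (size c) (size r) (size s))) sz ,
    trans (sym (weight-eq g h (weight c) (weight r) (weight s))) wt , suc-injective rt
  to-from : ∀ y → to (from y) ≡ y
  to-from (inj₁ _)                                = cong inj₁ (subset-≡ 3≡-irrelevant refl)
  to-from (inj₂ (cons h c (cons g r s) , _ , _ , _)) = cong inj₂ (subset-≡ 3≡-irrelevant refl)
  from-to : ∀ x → from (to x) ≡ x
  from-to (cons g nil s , _ , _ , _)          = subset-≡ 3≡-irrelevant refl
  from-to (cons g (cons h c r) s , _ , _ , _) = subset-≡ 3≡-irrelevant refl

-- The extra label is lowered by one; if it was one already, it disappears and a bare forest
-- remains.
planted-split : ∀ {m w j} → Planted m (suc w) j ↔ (Forests m w j ⊎ Planted m w j)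
planted-split {m} {w} {j} = mk↔ₛ′ to from to-from from-to
  where
  to : Planted m (suc w) j → Forests m w j ⊎ Planted m w j
  to ((zero  , f) , sz , wt , rt) = inj₁ (f , sz , suc-injective wt , rt)
  to ((suc g , f) , sz , wt , rt) = inj₂ ((g , f) , sz , suc-injective wt , rt)
  from : Forests m w j ⊎ Planted m w j → Planted m (suc w) j
  from (inj₁ (f , sz , wt , rt))       = (zero , f) , sz , cong suc wt , rt
  from (inj₂ ((g , f) , sz , wt , rt)) = (suc g , f) , sz , cong suc wt , rt
  to-from : ∀ y → to (from y) ≡ y
  to-from (inj₁ _) = cong inj₁ (subset-≡ 3≡-irrelevant refl)
  to-from (inj₂ _) = cong inj₂ (subset-≡ 3≡-irrelevant refl)
  from-to : ∀ x → from (to x) ≡ x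
  from-to ((zero  , f) , _) = subset-≡ 3≡-irrelevant refl
  from-to ((suc g , f) , _) = subset-≡ 3≡-irrelevant refl

-- Counting labelled forests

⊎↔Fin : ∀ {A X Y : Set} {m n k} → A ↔ (X ⊎ Y) → X ↔ Fin m → Y ↔ Fin n → m + n ≡ k → A ↔ Fin k
⊎↔Fin split x y refl = ↔-sym +↔⊎ ↔-∘ ((x ⊎-↔ y) ↔-∘ split)

-- The number of compositions of w into m positive parts.
compositions : ℕ → ℕ → ℕ
compositions zero    zero    = 1
compositions zero    (suc m) = 0
compositions (suc w) zero    = 0
compositions (suc w) (suc m) = w C m

-- The right-hand side is `compositions (suc w) (suc m)`: its first part is one and is removed, or
-- is lowered by one.
compositions-pascal : ∀ w m → compositions w m + compositions w (suc m) ≡ w C m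
compositions-pascal zero    zero    = refl
compositions-pascal zero    (suc m) = sym (k>n⇒nCk≡0 {0} {suc m} (s≤s z≤n))
compositions-pascal (suc w) zero    = refl
compositions-pascal (suc w) (suc m) = nCk+nC[k+1]≡[n+1]C[k+1] w m

-- With `b` shapes, the extra label only adds a part to the composition of the weight. The induction
-- on `w` uses the forest counts at all smaller weights.
planted-count : ∀ {m j b} → (∀ w → Forests m w j ↔ Fin (b * compositions w m)) →
                ∀ w → Planted m w j ↔ Fin (b * compositions w (suc m))
planted-count {b = b} forests zero = empty↔Fin (*-zeroʳ b) λ ()
planted-count {m} {b = b} forests (suc w) =
  ⊎↔Fin planted-split (forests w) (planted-count {b = b} forests w)
    (trans (sym (*-distribˡ-+ b (compositions w m) (compositions w (suc m))))
           (cong (b *_) (compositions-pascal w m)))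

mutual
  forests-count : ∀ m w j → Forests m w j ↔ Fin (B m j * compositions w m)
  forests-count zero zero zero =
    mk↔ₛ′ (λ _ → zero) (λ _ → nil , refl , refl , refl) (λ { zero → refl })
      (λ { (nil , _) → subset-≡ 3≡-irrelevant refl ; (cons _ _ _ , () , _) })
  forests-count zero    (suc w) zero    = empty↔Fin refl λ { (nil , _ , () , _) }
  forests-count zero    w       (suc j) = empty↔Fin refl λ { (nil , _ , _ , ()) }
  forests-count (suc m) w       zero    = empty↔Fin refl λ { (nil , () , _) ; (cons _ _ _ , _ , _ , ()) }
  forests-count (suc m) w       (suc j) = rooted-count (suc m) m w j (m≤m+n (suc m) j)

  -- The recurrence raises the number of roots at fixed size. The bound `d` limits the steps until
  -- `j` exceeds `m`, where there would be more roots than nodes and both sides vanish.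
  rooted-count : ∀ d m w j → m < d + j → Forests (suc m) w (suc j) ↔ Fin (B (suc m) (suc j) * compositions w (suc m))
  rooted-count zero m w j m<j =
    empty↔Fin (cong (_* compositions w (suc m)) (B-vanish (s≤s m<j)))
      λ { (f , sz , _ , rt) → <⇒≱ (s≤s m<j) (subst₂ _≤_ rt sz (roots≤size f)) }
  rooted-count (suc d) m w j m<d+j =
    ⊎↔Fin forests-split
      (planted-count {b = B m j} (λ w′ → forests-count m w′ j) w)
      (rooted-count d m w (suc j) (subst (m <_) (sym (+-suc d j)) m<d+j))
      (trans (sym (*-distribʳ-+ (compositions w (suc m)) (B m j) (B (suc m) (suc (suc j)))))
             (cong (_* compositions w (suc m)) (sym (B-recurrence m j))))

-- Height sequences and forests

-- For a nonempty `f`, the first height in `decode b f` is one less than `b + rootWeight f`.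
rootWeight : Forest → ℕ
rootWeight nil          = 0
rootWeight (cons g c s) = suc (g + rootWeight s)

-- The root labels are the gaps between successive left-to-right minima, read
-- from the last minimum upwards; the children of a root form the columns
-- between it and the next minimum, measured from its height.
decode : ℕ → Forest → List ℕ
decode b nil          = []
decode b (cons g c s) = (b + (g + rootWeight s)) ∷ decode (b + (g + rootWeight s)) c ++ decode b s

-- The forest of the sequence that remains when the first column, of height
-- g + rootWeight s, is deleted from that of cons g c s.
merge : ℕ → Forest → Forest → Forest
merge g nil                        s = s
merge g (cons a c nil)             s = cons (g + a) c s
merge g (cons a c r@(cons _ _ _))  s = cons a c (merge g r s)

-- The children of the deleted root are promoted to roots with their labels, the last one enlarged
-- by `g`.
rootWeight-merge : ∀ g {a c r} s →
  rootWeight (merge g (cons a c r) s) ≡ (g + rootWeight s) + rootWeight (cons a c r)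
rootWeight-merge g {a} {c} {nil} s = eq g a (rootWeight s)
  where
  eq : ∀ g a x → suc (g + a + x) ≡ (g + x) + suc (a + 0)
  eq = solve-∀
rootWeight-merge g {a} {c} {r@(cons a′ c′ r′)} s =
  trans (cong (λ x → suc (a + x)) (rootWeight-merge g {a′} {c′} {r′} s)) (eq a (g + rootWeight s) (rootWeight r))
  where
  eq : ∀ a x y → suc (a + (x + y)) ≡ x + suc (a + y)
  eq = solve-∀

-- Of its label `suc g` the deleted root passes `g` on to its last child, so exactly one unit of
-- weight is lost.
weight-merge : ∀ g {a c r} s →
  weight (merge g (cons a c r) s) ≡ g + (weight (cons a c r) + weight s)
weight-merge g {a} {c} {nil} s = eq g a (weight c) (weight s)
  where
  eq : ∀ g a x y → suc (g + a) + (x + y) ≡ g + (suc a + (x + 0) + y)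
  eq = solve-∀
weight-merge g {a} {c} {r@(cons a′ c′ r′)} s =
  trans (cong (λ x → suc a + (weight c + x)) (weight-merge g {a′} {c′} {r′} s))
        (eq g a (weight c) (weight r) (weight s))
  where
  eq : ∀ g a x y z → suc a + (x + (g + (y + z))) ≡ g + (suc a + (x + y) + z)
  eq = solve-∀

-- This justifies `merge`: the right-hand side is the tail of `decode b (cons g c s)`.
decode-merge : ∀ b g c s → decode b (merge g c s) ≡ decode (b + (g + rootWeight s)) c ++ decode b s
decode-merge b g nil s = refl
decode-merge b g (cons a c nil) s =
  trans (cong (λ h → h ∷ decode h c ++ decode b s) (eq b g a (rootWeight s)))
        (cong (λ l → h′ ∷ l ++ decode b s) (sym (++-identityʳ (decode h′ c))))
  where
  h′ = b + (g + rootWeight s) + (a + 0)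
  eq : ∀ b g a x → b + (g + a + x) ≡ b + (g + x) + (a + 0)
  eq = solve-∀
decode-merge b g (cons a c r@(cons a′ c′ r′)) s = begin
  h₀ ∷ decode h₀ c ++ decode b (merge g r s)  ≡⟨ cong (λ h → h ∷ decode h c ++ decode b (merge g r s)) heads ⟩
  h′ ∷ decode h′ c ++ decode b (merge g r s)  ≡⟨ cong (λ l → h′ ∷ decode h′ c ++ l) (decode-merge b g r s) ⟩
  h′ ∷ decode h′ c ++ decode h r ++ decode b s ≡⟨ cong (h′ ∷_) (sym (++-assoc (decode h′ c) (decode h r) (decode b s))) ⟩
  h′ ∷ (decode h′ c ++ decode h r) ++ decode b s ∎
  where
  open ≡-Reasoning
  h  = b + (g + rootWeight s)
  h₀ = b + (a + rootWeight (merge g r s))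
  h′ = h + (a + rootWeight r)
  eq : ∀ b a x y → b + (a + (x + y)) ≡ b + x + (a + y)
  eq = solve-∀
  heads : h₀ ≡ h′
  heads = trans (cong (λ x → b + (a + x)) (rootWeight-merge g {a′} {c′} {r′} s))
                (eq b a (g + rootWeight s) (rootWeight r))

decode-cons : ∀ g c s → decode 0 (cons g c s) ≡ (g + rootWeight s) ∷ decode 0 (merge g c s)
decode-cons g c s = cong ((g + rootWeight s) ∷_) (sym (decode-merge 0 g c s))

-- A column of height `h` is put in front of the sequence of `f`: the roots of height at least `h`
-- become its children, the lower ones its siblings.
unmerge : ∀ h f → ∃[ g ] ∃[ c ] ∃[ s ] g + rootWeight s ≡ h × merge g c s ≡ f
unmerge h nil = h , nil , nil , +-identityʳ h , refl
unmerge h (cons a c s) with ≤-<-connex (rootWeight s) h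
... | inj₂ h<s with unmerge h s
-- Without children `s′` would be `s` itself, forcing `rootWeight s ≤ h`.
...   | g , nil , s′ , gs≡h , refl =
        contradiction h<s (≤⇒≯ (subst (rootWeight s ≤_) gs≡h (m≤n+m (rootWeight s) g)))
...   | g , r@(cons _ _ _) , s′ , gs≡h , merge≡s = g , cons a c r , s′ , gs≡h , cong (cons a c) merge≡s
unmerge h (cons a c s) | inj₁ s≤h with ≤-<-connex h (a + rootWeight s)
-- This root is the last one not below `h`, hence the last child; its label is divided at height `h`
-- between it and the new root.
... | inj₁ h≤as = h ∸ rootWeight s , cons (a ∸ (h ∸ rootWeight s)) c nil , s , m∸n+n≡m s≤h ,
                  cong (λ x → cons x c s) (m+[n∸m]≡n (m≤n+o⇒m∸n≤o h (rootWeight s) (subst (h ≤_) (+-comm a _) h≤as)))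
-- Even the first root lies below `h`, so the new column is a leaf.
... | inj₂ as<h = h ∸ rootWeight (cons a c s) , nil , cons a c s , m∸n+n≡m as<h , refl

-- Separates leaves from inner roots: merging in children pushes the root weight above the deleted
-- height, whereas the siblings `s′` of a root of that height stay within it.
merge-overshoots : ∀ g {a c r} s {g′ s′} → g + rootWeight s ≡ g′ + rootWeight s′ →
                   ¬ (s′ ≡ merge g (cons a c r) s)
merge-overshoots g {a} {c} {r} s {g′} {s′} eq refl = <-irrefl eq (begin-strict
  g + rootWeight s                              <⟨ m<m+n (g + rootWeight s) (s≤s z≤n) ⟩
  g + rootWeight s + rootWeight (cons a c r)    ≡⟨ rootWeight-merge g {a} {c} {r} s ⟨
  rootWeight s′                                 ≤⟨ m≤n+m (rootWeight s′) g′ ⟩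
  g′ + rootWeight s′                            ∎)
  where open ≤-Reasoning

cons-injective : ∀ {g g′ c c′ s s′} → cons g c s ≡ cons g′ c′ s′ → g ≡ g′ × c ≡ c′ × s ≡ s′
cons-injective refl = refl , refl , refl

-- The two lists of children are compared in parallel; `merge-overshoots` excludes that one ends
-- before the other.
merge-injective : ∀ {g g′} c c′ {s s′} → g + rootWeight s ≡ g′ + rootWeight s′ →
                  merge g c s ≡ merge g′ c′ s′ → cons g c s ≡ cons g′ c′ s′
merge-injective nil nil {s} heads refl = cong (λ x → cons x nil s) (+-cancelʳ-≡ (rootWeight s) _ _ heads)
merge-injective nil (cons _ _ _) {s} {s′} heads eq = ⊥-elim (merge-overshoots _ s′ (sym heads) eq)
merge-injective (cons _ _ _) nil {s} {s′} heads eq = ⊥-elim (merge-overshoots _ s heads (sym eq))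
merge-injective {g} {g′} (cons a c nil) (cons a′ c′ nil) {s} heads eq with cons-injective eq
... | ga≡ga′ , refl , refl with +-cancelʳ-≡ (rootWeight s) g g′ heads
...   | refl = cong (λ x → cons g (cons x c nil) s) (+-cancelˡ-≡ g a a′ ga≡ga′)
merge-injective (cons a c nil) (cons a′ c′ (cons _ _ _)) {s} {s′} heads eq =
  ⊥-elim (merge-overshoots _ s′ (sym heads) (proj₂ (proj₂ (cons-injective eq))))
merge-injective (cons a c (cons _ _ _)) (cons a′ c′ nil) {s} {s′} heads eq =
  ⊥-elim (merge-overshoots _ s heads (sym (proj₂ (proj₂ (cons-injective eq)))))
merge-injective (cons a c r@(cons _ _ _)) (cons a′ c′ r′@(cons _ _ _)) heads eq =
  let a≡a′ , c≡c′ , eq′ = cons-injective eq in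
  graft a≡a′ c≡c′ (merge-injective r r′ heads eq′)
  where
  graft : ∀ {g g′ a a′ c c′ r r′ s s′} → a ≡ a′ → c ≡ c′ → cons g r s ≡ cons g′ r′ s′ →
          cons g (cons a c r) s ≡ cons g′ (cons a′ c′ r′) s′
  graft refl refl refl = refl

-- The list is an argument of its own because the recursion passes to `merge g c s`, which is no
-- subterm of `cons g c s`.
decode-injective : ∀ l f f′ → decode 0 f ≡ l → decode 0 f′ ≡ l → f ≡ f′
decode-injective []      nil          nil             _  _   = refl
decode-injective (h ∷ l) (cons g c s) (cons g′ c′ s′) eq eq′
  with ∷-injective (trans (sym (decode-cons g c s)) eq) | ∷-injective (trans (sym (decode-cons g′ c′ s′)) eq′)
... | head≡ , tail≡ | head≡′ , tail≡′ =
  merge-injective c c′ (trans head≡ (sym head≡′)) (decode-injective l _ _ tail≡ tail≡′)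

decode-surjective : ∀ l → ∃[ f ] decode 0 f ≡ l
decode-surjective []      = nil , refl
decode-surjective (h ∷ l) with decode-surjective l
... | f , refl with unmerge h f
...   | g , c , s , refl , refl = cons g c s , decode-cons g c s

-- Length, rises and left-to-right minima of a decoded forest

length-decode : ∀ b f → length (decode b f) ≡ size f
length-decode b nil          = refl
length-decode b (cons g c s) =
  cong suc (trans (length-++ (decode _ c)) (cong₂ _+_ (length-decode _ c) (length-decode b s)))

-- Total ascent of the upper boundary: a column starts one row above its predecessor of height `p`,
-- so its top is higher by `suc h ∸ p`, truncated at zero for a descent.
rises : ℕ → List ℕ → ℕ
rises p []       = 0
rises p (h ∷ hs) = (suc h ∸ p) + rises h hs

-- If the first root is a leaf, the truncated difference in the hypothesis is zero; otherwise it is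
-- the root weight of the children.
rises-step : ∀ {k} g c s {r} → r + rootWeight (merge g c s) ≡ weight (merge g c s) + (rootWeight (merge g c s) ∸ (g + rootWeight s)) →
             k + r + suc (g + rootWeight s) ≡ weight (cons g c s) + k
rises-step {k} g nil s {r} ih = begin
  k + r + suc (g + rootWeight s)      ≡⟨ eq k r g (rootWeight s) ⟩
  suc g + (r + rootWeight s) + k      ≡⟨ cong (λ x → suc g + x + k) ih ⟩
  suc g + (weight s + (rootWeight s ∸ (g + rootWeight s))) + k
    ≡⟨ cong (λ x → suc g + (weight s + x) + k) (m≤n⇒m∸n≡0 (m≤n+m (rootWeight s) g)) ⟩
  suc g + (weight s + 0) + k          ≡⟨ cong (λ x → suc g + x + k) (+-identityʳ (weight s)) ⟩
  suc g + weight s + k                ∎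
  where
  open ≡-Reasoning
  eq : ∀ k r g x → k + r + suc (g + x) ≡ suc g + (r + x) + k
  eq = solve-∀
rises-step {k} g c@(cons a c′ r′) s {r} ih = begin
  k + r + suc h                   ≡⟨ eq k r h ⟩
  suc (r + h) + k                 ≡⟨ cong (λ x → suc x + k) r+h≡ ⟩
  suc (g + (weight c + weight s)) + k  ∎
  where
  open ≡-Reasoning
  h = g + rootWeight s
  eq : ∀ k r h → k + r + suc h ≡ suc (r + h) + k
  eq = solve-∀
  r+h≡ : r + h ≡ g + (weight c + weight s)
  r+h≡ = +-cancelʳ-≡ (rootWeight c) _ _ (begin
    r + h + rootWeight c              ≡⟨ +-assoc r h _ ⟩
    r + (h + rootWeight c)            ≡⟨ cong (r +_) (rootWeight-merge g {a} {c′} {r′} s) ⟨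
    r + rootWeight (merge g c s)      ≡⟨ ih ⟩
    weight (merge g c s) + (rootWeight (merge g c s) ∸ h)
      ≡⟨ cong₂ _+_ (weight-merge g {a} {c′} {r′} s) (trans (cong (_∸ h) (rootWeight-merge g {a} {c′} {r′} s)) (m+n∸m≡n h _)) ⟩
    g + (weight c + weight s) + rootWeight c ∎)

-- For nonempty `f` the first rise is `rootWeight f ∸ p`, so the claim is that the later rises add
-- up to the labels of the nodes that are not roots.
rises-decode : ∀ p l f → decode 0 f ≡ l → rises p l + rootWeight f ≡ weight f + (rootWeight f ∸ p)
rises-decode p []      nil          _  = sym (0∸n≡0 p)
rises-decode p (h ∷ l) (cons g c s) eq with ∷-injective (trans (sym (decode-cons g c s)) eq)
... | refl , tail≡ = rises-step g c s (rises-decode h l (merge g c s) tail≡)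

rises₀-decode : ∀ f → rises 0 (decode 0 f) ≡ weight f
rises₀-decode f = +-cancelʳ-≡ (rootWeight f) _ _ (rises-decode 0 (decode 0 f) f refl)

-- Root heights decrease strictly along the siblings, so all roots count from the first one below
-- `μ` on.
rootsBelow : ℕ → Forest → ℕ
rootsBelow μ nil          = 0
rootsBelow μ (cons g c s) = if g + rootWeight s <ᵇ μ then suc (roots s) else rootsBelow μ s

<ᵇ-true : ∀ {m n} → m < n → (m <ᵇ n) ≡ true
<ᵇ-true {m} {n} m<n with m <ᵇ n | <⇒<ᵇ m<n
... | true | _ = refl

<ᵇ-false : ∀ {m n} → n ≤ m → (m <ᵇ n) ≡ false
<ᵇ-false {m} {n} n≤m with m <ᵇ n in eq
... | false = refl
... | true  = contradiction (<ᵇ⇒< m n (subst T (sym eq) _)) (≤⇒≯ n≤m)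

rootsBelow-all : ∀ {μ} f → rootWeight f ≤ μ → rootsBelow μ f ≡ roots f
rootsBelow-all nil          _   = refl
rootsBelow-all (cons g c s) w≤μ rewrite <ᵇ-true w≤μ = refl

rootsBelow-skip : ∀ {μ} g c s → μ ≤ g + rootWeight s → rootsBelow μ (cons g c s) ≡ rootsBelow μ s
rootsBelow-skip g c s μ≤ rewrite <ᵇ-false μ≤ = refl

-- The promoted children are at least as high as the deleted root, hence not below `μ`.
rootsBelow-merge : ∀ {μ} g c s → μ ≤ g + rootWeight s → rootsBelow μ (merge g c s) ≡ rootsBelow μ s
rootsBelow-merge g nil            s _  = refl
rootsBelow-merge g (cons a c nil) s μ≤ =
  rootsBelow-skip (g + a) c s (≤-trans μ≤ (+-monoˡ-≤ (rootWeight s) (m≤m+n g a)))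
rootsBelow-merge {μ} g (cons a c r@(cons a′ c′ r′)) s μ≤ =
  trans (rootsBelow-skip a c (merge g r s) μ≤′) (rootsBelow-merge g r s μ≤)
  where
  open ≤-Reasoning
  μ≤′ : μ ≤ a + rootWeight (merge g r s)
  μ≤′ = begin
    μ                                   ≤⟨ μ≤ ⟩
    g + rootWeight s                    ≤⟨ m≤m+n _ (rootWeight r) ⟩
    g + rootWeight s + rootWeight r     ≡⟨ rootWeight-merge g {a′} {c′} {r′} s ⟨
    rootWeight (merge g r s)            ≤⟨ m≤n+m _ a ⟩
    a + rootWeight (merge g r s)        ∎

-- The minima still to come are the roots below the running minimum. A column of height at least `μ`
-- leaves them unchanged when deleted; a lower one is itself the first of them.
lminFrom-decode : ∀ μ l f → decode 0 f ≡ l → lminFrom μ l ≡ rootsBelow μ f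
lminFrom-decode μ []      nil          _  = refl
lminFrom-decode μ (h ∷ l) (cons g c s) eq with ∷-injective (trans (sym (decode-cons g c s)) eq)
... | refl , tail≡ with ≤-<-connex μ h
...   | inj₁ μ≤h rewrite <ᵇ-false μ≤h | m≤n⇒m⊓n≡m μ≤h =
        trans (lminFrom-decode μ l (merge g c s) tail≡) (rootsBelow-merge g c s μ≤h)
...   | inj₂ h<μ rewrite <ᵇ-true h<μ | m≥n⇒m⊓n≡n (<⇒≤ h<μ) =
        cong suc (trans (lminFrom-decode h l (merge g c s) tail≡)
          (trans (rootsBelow-merge g c s ≤-refl) (rootsBelow-all s (m≤n+m _ g))))

lminHeights-decode : ∀ f → lminHeights (decode 0 f) ≡ roots f
lminHeights-decode nil          = refl
lminHeights-decode (cons g c s) =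
  trans (cong lminHeights (decode-cons g c s))
    (cong suc (trans (lminFrom-decode h _ (merge g c s) refl)
      (trans (rootsBelow-merge g c s ≤-refl) (rootsBelow-all s (m≤n+m _ g)))))
  where h = g + rootWeight s

-- Semiperimeters

-- The Iverson bracket.
ι : ∀ {A : Set} → Dec A → ℕ
ι a? = if does a? then 1 else 0

ι-yes : ∀ {A : Set} (a? : Dec A) → A → ι a? ≡ 1
ι-yes a? a = cong (if_then 1 else 0) (dec-true a? a)

ι-no : ∀ {A : Set} (a? : Dec A) → ¬ A → ι a? ≡ 0
ι-no a? ¬a = cong (if_then 1 else 0) (dec-false a? ¬a)

ι-⇔ : ∀ {A B : Set} → A ⇔ B → (a? : Dec A) (b? : Dec B) → ι a? ≡ ι b?
ι-⇔ A⇔B a? b? = cong (if_then 1 else 0) (does-⇔ A⇔B a? b?)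

ι-⊎ : ∀ {A B : Set} (a? : Dec A) (b? : Dec B) → (A → ¬ B) → ι (a? ⊎-dec b?) ≡ ι a? + ι b?
ι-⊎ (no  _) b?      _     = refl
ι-⊎ (yes _) (no _)  _     = refl
ι-⊎ (yes a) (yes b) a→¬b  = contradiction b (a→¬b a)

∑< : ℕ → (ℕ → ℕ) → ℕ
∑< zero    f = 0
∑< (suc n) f = f 0 + ∑< n (f ∘ suc)

∑<-cong : ∀ n {f g} → (∀ k → k < n → f k ≡ g k) → ∑< n f ≡ ∑< n g
∑<-cong zero    eq = refl
∑<-cong (suc n) eq = cong₂ _+_ (eq 0 (s≤s z≤n)) (∑<-cong n (λ k k<n → eq (suc k) (s≤s k<n)))

∑<-zero : ∀ n {f} → (∀ k → f k ≡ 0) → ∑< n f ≡ 0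
∑<-zero zero    eq = refl
∑<-zero (suc n) eq = cong₂ _+_ (eq 0) (∑<-zero n (eq ∘ suc))

∑<-+ : ∀ n f g → ∑< n (λ k → f k + g k) ≡ ∑< n f + ∑< n g
∑<-+ zero    f g = refl
∑<-+ (suc n) f g = trans (cong (f 0 + g 0 +_) (∑<-+ n (f ∘ suc) (g ∘ suc)))
  (+-interchange (f 0) (g 0) _ _)

∑<-δ : ∀ n j → ∑< n (λ k → ι (j ≟ k)) ≡ ι (j <? n)
∑<-δ zero    j       = refl
∑<-δ (suc n) zero    = cong suc (∑<-zero n (λ _ → refl))
∑<-δ (suc n) (suc j) = ∑<-δ n j

-- Used for edges of a column that are shared with a second cell exactly when `k < q`; the others
-- are boundary edges.
∑<-threshold : ∀ n q → ∑< n (λ k → ι (suc (ι (k <? q)) ≟ 1)) ≡ n ∸ q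
∑<-threshold zero    q       = sym (0∸n≡0 q)
∑<-threshold (suc n) zero    = cong suc (∑<-threshold n zero)
∑<-threshold (suc n) (suc q) = ∑<-threshold n q

length-filter-∷ : ∀ {A : Set} {P : A → Set} (P? : Decidable P) x xs →
                  length (filter P? (x ∷ xs)) ≡ ι (P? x) + length (filter P? xs)
length-filter-∷ P? x xs with does (P? x)
... | true  = refl
... | false = refl

length-filter-++ : ∀ {A : Set} {P : A → Set} (P? : Decidable P) xs ys →
                   length (filter P? (xs ++ ys)) ≡ length (filter P? xs) + length (filter P? ys)
length-filter-++ P? xs ys = trans (cong length (filter-++ P? xs ys)) (length-++ (filter P? xs))

length-filter-applyUpTo : ∀ {A : Set} {P : A → Set} (P? : Decidable P) f n →
                          length (filter P? (applyUpTo f n)) ≡ ∑< n (λ k → ι (P? (f k)))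
length-filter-applyUpTo P? f zero    = refl
length-filter-applyUpTo P? f (suc n) =
  trans (length-filter-∷ P? (f 0) _) (cong (ι (P? (f 0)) +_) (length-filter-applyUpTo P? (f ∘ suc) n))

column : ℕ → ℕ → List Cell
column i h = map (λ k → i , i + k) (upTo h)

column≡applyUpTo : ∀ i h → column i h ≡ applyUpTo (λ k → i , i + k) h
column≡applyUpTo i h = map-applyUpTo id (λ k → i , i + k) h

occurrences : (Cell → List Edge) → Edge → List Cell → ℕ
occurrences edges e cs = length (filter (λ c → e ∈? edges c) cs)

-- The length of the boundary part of es when O e cells contain the edge e.
boundaryCount : (Edge → ℕ) → List Edge → ℕ
boundaryCount O es = length (filter (λ e → O e ≟ 1) es)

module _ (edges : Cell → List Edge) where

  occurrences-column : ∀ e i h → occurrences edges e (column i h) ≡ ∑< h (λ k → ι (e ∈? edges (i , i + k)))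
  occurrences-column e i h =
    trans (cong (occurrences edges e) (column≡applyUpTo i h)) (length-filter-applyUpTo (λ c → e ∈? edges c) _ h)

  occurrences-none : ∀ e i h → (∀ k → ¬ (e ∈ edges (i , i + k))) → occurrences edges e (column i h) ≡ 0
  occurrences-none e i h e∉ =
    trans (occurrences-column e i h) (∑<-zero h (λ k → ι-no (e ∈? edges (i , i + k)) (e∉ k)))

  occurrences-++ : ∀ e cs ds → occurrences edges e (cs ++ ds) ≡ occurrences edges e cs + occurrences edges e ds
  occurrences-++ e = length-filter-++ (λ c → e ∈? edges c)

  module _ (not-left : ∀ {x y} c → x < proj₁ c → ¬ ((x , y) ∈ edges c)) where

    occurrences-later : ∀ x y i hs → x < i → occurrences edges (x , y) (columnsFrom i hs) ≡ 0
    occurrences-later x y i []       x<i = refl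
    occurrences-later x y i (h ∷ hs) x<i =
      trans (occurrences-++ (x , y) (column i h) (columnsFrom (suc i) hs))
        (cong₂ _+_ (occurrences-none (x , y) i h (λ k → not-left (i , i + k) x<i))
                   (occurrences-later x y (suc i) hs (m<n⇒m<1+n x<i)))

  boundaryCount-++ : ∀ O cs ds → boundaryCount O (concatMap edges (cs ++ ds)) ≡
                                 boundaryCount O (concatMap edges cs) + boundaryCount O (concatMap edges ds)
  boundaryCount-++ O cs ds =
    trans (cong (boundaryCount O) (concatMap-++ edges cs ds))
          (length-filter-++ (λ e → O e ≟ 1) (concatMap edges cs) (concatMap edges ds))

module _ (O : Edge → ℕ) (e₁ e₂ : Cell → Edge) where

  private
    edges : Cell → List Edge
    edges c = e₁ c ∷ e₂ c ∷ []

  boundaryCount-applyUpTo : ∀ f n → boundaryCount O (concatMap edges (applyUpTo f n)) ≡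
    ∑< n (λ k → ι (O (e₁ (f k)) ≟ 1)) + ∑< n (λ k → ι (O (e₂ (f k)) ≟ 1))
  boundaryCount-applyUpTo f zero    = refl
  boundaryCount-applyUpTo f (suc n) = begin
    boundaryCount O (e₁ (f 0) ∷ e₂ (f 0) ∷ rest)
      ≡⟨ length-filter-∷ (λ e → O e ≟ 1) (e₁ (f 0)) _ ⟩
    a + boundaryCount O (e₂ (f 0) ∷ rest)
      ≡⟨ cong (a +_) (length-filter-∷ (λ e → O e ≟ 1) (e₂ (f 0)) rest) ⟩
    a + (b + boundaryCount O rest)
      ≡⟨ cong (λ x → a + (b + x)) (boundaryCount-applyUpTo (f ∘ suc) n) ⟩
    a + (b + (a′ + b′))
      ≡⟨ +-assoc a b (a′ + b′) ⟨
    a + b + (a′ + b′)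
      ≡⟨ +-interchange a b a′ b′ ⟩
    (a + a′) + (b + b′) ∎
    where
    open ≡-Reasoning
    rest = concatMap edges (applyUpTo (f ∘ suc) n)
    a = ι (O (e₁ (f 0)) ≟ 1)
    b = ι (O (e₂ (f 0)) ≟ 1)
    a′ = ∑< n (λ k → ι (O (e₁ (f (suc k))) ≟ 1))
    b′ = ∑< n (λ k → ι (O (e₂ (f (suc k))) ≟ 1))

  boundaryCount-column : ∀ i h → boundaryCount O (concatMap edges (column i h)) ≡
    ∑< h (λ k → ι (O (e₁ (i , i + k)) ≟ 1)) + ∑< h (λ k → ι (O (e₂ (i , i + k)) ≟ 1))
  boundaryCount-column i h =
    trans (cong (boundaryCount O ∘ concatMap edges) (column≡applyUpTo i h)) (boundaryCount-applyUpTo _ h)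

-- Horizontal boundary edges

horizontal-not-left : ∀ {x y} c → x < proj₁ c → ¬ ((x , y) ∈ horizontalEdges c)
horizontal-not-left c x<c (here refl)         = <-irrefl refl x<c
horizontal-not-left c x<c (there (here refl)) = <-irrefl refl x<c

∈horizontal⇔ : ∀ x j k → ((x , x + j) ∈ horizontalEdges (x , x + k)) ⇔ (j ≡ k ⊎ j ≡ suc k)
∈horizontal⇔ x j k = mk⇔ to from
  where
  to : (x , x + j) ∈ horizontalEdges (x , x + k) → j ≡ k ⊎ j ≡ suc k
  to (here eq)         = inj₁ (+-cancelˡ-≡ x j k (cong proj₂ eq))
  to (there (here eq)) = inj₂ (+-cancelˡ-≡ x j (suc k) (trans (cong proj₂ eq) (sym (+-suc x k))))
  from : j ≡ k ⊎ j ≡ suc k → (x , x + j) ∈ horizontalEdges (x , x + k)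
  from (inj₁ refl) = here refl
  from (inj₂ refl) = there (here (cong (x ,_) (+-suc x k)))

-- The edge at offset `j` is the bottom of cell `j` and, for positive `j`, the top of the cell
-- beneath; each possibility gives one summand.
horizontal-own : ∀ i h j → occurrences horizontalEdges (i , i + j) (column i h) ≡
                           ι (j <? h) + ∑< h (λ k → ι (j ≟ suc k))
horizontal-own i h j = begin
  occurrences horizontalEdges (i , i + j) (column i h)
    ≡⟨ occurrences-column horizontalEdges (i , i + j) i h ⟩
  ∑< h (λ k → ι ((i , i + j) ∈? horizontalEdges (i , i + k)))
    ≡⟨ ∑<-cong h (λ k _ → pointwise k) ⟩
  ∑< h (λ k → ι (j ≟ k) + ι (j ≟ suc k))
    ≡⟨ ∑<-+ h (λ k → ι (j ≟ k)) (λ k → ι (j ≟ suc k)) ⟩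
  ∑< h (λ k → ι (j ≟ k)) + ∑< h (λ k → ι (j ≟ suc k))
    ≡⟨ cong (_+ ∑< h (λ k → ι (j ≟ suc k))) (∑<-δ h j) ⟩
  ι (j <? h) + ∑< h (λ k → ι (j ≟ suc k)) ∎
  where
  open ≡-Reasoning
  pointwise : ∀ k → ι ((i , i + j) ∈? horizontalEdges (i , i + k)) ≡ ι (j ≟ k) + ι (j ≟ suc k)
  pointwise k = trans (ι-⇔ (∈horizontal⇔ i j k) ((i , i + j) ∈? horizontalEdges (i , i + k)) (j ≟ k ⊎-dec j ≟ suc k))
    (ι-⊎ (j ≟ k) (j ≟ suc k) (λ { refl → <⇒≢ (n<1+n k) }))

-- Edges between two cells of the column occur twice, so only the lowest bottom and the highest top
-- remain.
horizontal-column : ∀ O i h → (∀ j → O (i , i + j) ≡ occurrences horizontalEdges (i , i + j) (column i (suc h))) →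
                    boundaryCount O (concatMap horizontalEdges (column i (suc h))) ≡ 2
horizontal-column O i h O≡ =
  trans (boundaryCount-column O (λ c → c) (λ c → proj₁ c , suc (proj₂ c)) i (suc h)) (cong₂ _+_ bottoms tops)
  where
  own : ∀ j → O (i , i + j) ≡ ι (j <? suc h) + ∑< (suc h) (λ k → ι (j ≟ suc k))
  own j = trans (O≡ j) (horizontal-own i (suc h) j)
  bottom : ∀ k → k < suc h → ι (O (i , i + k) ≟ 1) ≡ ι (0 ≟ k)
  bottom zero    _   = cong (λ x → ι (x ≟ 1)) (trans (own 0) (cong suc (∑<-zero h (λ _ → refl))))
  bottom (suc k) k<h = cong (λ x → ι (x ≟ 1)) (trans (own (suc k))
    (cong₂ _+_ (ι-yes (suc k <? suc h) k<h) (trans (∑<-δ (suc h) k) (ι-yes (k <? suc h) (<⇒≤ k<h)))))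
  bottoms : ∑< (suc h) (λ k → ι (O (i , i + k) ≟ 1)) ≡ 1
  bottoms = trans (∑<-cong (suc h) bottom) (∑<-δ (suc h) 0)
  top : ∀ k → k < suc h → ι (O (i , suc (i + k)) ≟ 1) ≡ ι (suc (ι (k <? h)) ≟ 1)
  top k k<h = cong (λ x → ι (x ≟ 1)) (begin
    O (i , suc (i + k))
      ≡⟨ cong (λ y → O (i , y)) (+-suc i k) ⟨
    O (i , i + suc k)
      ≡⟨ own (suc k) ⟩
    ι (k <? h) + ∑< (suc h) (λ l → ι (k ≟ l))
      ≡⟨ cong (ι (k <? h) +_) (trans (∑<-δ (suc h) k) (ι-yes (k <? suc h) k<h)) ⟩
    ι (k <? h) + 1
      ≡⟨ +-comm (ι (k <? h)) 1 ⟩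
    suc (ι (k <? h)) ∎)
    where open ≡-Reasoning
  tops : ∑< (suc h) (λ k → ι (O (i , suc (i + k)) ≟ 1)) ≡ 1
  tops = trans (∑<-cong (suc h) top) (trans (∑<-threshold (suc h) h) (m+n∸n≡m 1 h))

-- `O` is kept fixed as the count over the whole polyomino while the induction peels off columns;
-- from column `i` on only the remaining cells contribute to it.
horizontal-columns : ∀ O i hs → All (1 ≤_) hs →
  (∀ x y → i ≤ x → O (x , y) ≡ occurrences horizontalEdges (x , y) (columnsFrom i hs)) →
  boundaryCount O (concatMap horizontalEdges (columnsFrom i hs)) ≡ 2 * length hs
horizontal-columns O i []           _          O≡ = refl
horizontal-columns O i (suc h ∷ hs) (_ ∷ 1≤hs) O≡ = begin
  boundaryCount O (concatMap horizontalEdges (column i (suc h) ++ columnsFrom (suc i) hs))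
    ≡⟨ boundaryCount-++ horizontalEdges O (column i (suc h)) (columnsFrom (suc i) hs) ⟩
  boundaryCount O (concatMap horizontalEdges (column i (suc h))) + boundaryCount O (concatMap horizontalEdges (columnsFrom (suc i) hs))
    ≡⟨ cong₂ _+_ (horizontal-column O i h first) (horizontal-columns O (suc i) hs 1≤hs later) ⟩
  2 + 2 * length hs
    ≡⟨ *-suc 2 (length hs) ⟨
  2 * suc (length hs) ∎
  where
  open ≡-Reasoning
  split : ∀ x y → occurrences horizontalEdges (x , y) (columnsFrom i (suc h ∷ hs)) ≡
    occurrences horizontalEdges (x , y) (column i (suc h)) + occurrences horizontalEdges (x , y) (columnsFrom (suc i) hs)
  split x y = occurrences-++ horizontalEdges (x , y) (column i (suc h)) (columnsFrom (suc i) hs)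
  first : ∀ j → O (i , i + j) ≡ occurrences horizontalEdges (i , i + j) (column i (suc h))
  first j = trans (O≡ i (i + j) ≤-refl) (trans (split i (i + j))
    (trans (cong (occurrences horizontalEdges (i , i + j) (column i (suc h)) +_)
             (occurrences-later horizontalEdges horizontal-not-left i (i + j) (suc i) hs ≤-refl)) (+-identityʳ _)))
  not-right : ∀ {x y} k → i < x → ¬ ((x , y) ∈ horizontalEdges (i , i + k))
  not-right k i<x (here refl)         = <-irrefl refl i<x
  not-right k i<x (there (here refl)) = <-irrefl refl i<x
  later : ∀ x y → suc i ≤ x → O (x , y) ≡ occurrences horizontalEdges (x , y) (columnsFrom (suc i) hs)
  later x y i<x = trans (O≡ x y (<⇒≤ i<x)) (trans (split x y)
    (cong (_+ _) (occurrences-none horizontalEdges (x , y) i (suc h) (λ k → not-right k i<x))))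

-- Vertical boundary edges

vertical-not-left : ∀ {x y} c → x < proj₁ c → ¬ ((x , y) ∈ verticalEdges c)
vertical-not-left c x<c (here refl)         = <-irrefl refl x<c
vertical-not-left c x<c (there (here refl)) = <-asym x<c ≤-refl

vertical-not-right : ∀ {x y} c → suc (proj₁ c) < x → ¬ ((x , y) ∈ verticalEdges c)
vertical-not-right c c<x (here refl)         = <-asym c<x ≤-refl
vertical-not-right c c<x (there (here refl)) = <-irrefl refl c<x

vertical-row : ∀ {x y} c → (x , y) ∈ verticalEdges c → y ≡ proj₂ c
vertical-row c (here refl)         = refl
vertical-row c (there (here refl)) = refl

vertical-own : ∀ x i j h → (∀ y → (x , y) ∈ verticalEdges (i , y)) →
               occurrences verticalEdges (x , i + j) (column i h) ≡ ι (j <? h)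
vertical-own x i j h x∈ = begin
  occurrences verticalEdges (x , i + j) (column i h)
    ≡⟨ occurrences-column verticalEdges (x , i + j) i h ⟩
  ∑< h (λ k → ι ((x , i + j) ∈? verticalEdges (i , i + k)))
    ≡⟨ ∑<-cong h (λ k _ → ι-⇔ (same-row k) ((x , i + j) ∈? verticalEdges (i , i + k)) (j ≟ k)) ⟩
  ∑< h (λ k → ι (j ≟ k))
    ≡⟨ ∑<-δ h j ⟩
  ι (j <? h) ∎
  where
  open ≡-Reasoning
  same-row : ∀ k → ((x , i + j) ∈ verticalEdges (i , i + k)) ⇔ (j ≡ k)
  same-row k = mk⇔ (λ e∈ → +-cancelˡ-≡ i j k (vertical-row (i , i + k) e∈)) (λ { refl → x∈ (i + k) })

head₀ : List ℕ → ℕ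
head₀ []      = 0
head₀ (h ∷ _) = h

-- The preceding column, of height `p`, starts one row lower and so covers `p ∸ 1` rows from the
-- bottom of this one; `p = 0` stands for no such column.
leftEdges : ℕ → List ℕ → ℕ
leftEdges p []       = 0
leftEdges p (h ∷ hs) = (h ∸ (p ∸ 1)) + leftEdges h hs

-- The next column starts one row higher, so the lowest right edge is always free, whence the outer
-- `suc`. After the last column `head₀` gives height zero.
rightEdges : List ℕ → ℕ
rightEdges []       = 0
rightEdges (h ∷ hs) = suc (h ∸ suc (head₀ hs)) + rightEdges hs

vertical-next : ∀ i k hs → occurrences verticalEdges (suc i , i + suc k) (columnsFrom (suc i) hs) ≡ ι (k <? head₀ hs)
vertical-next i k []       = refl
vertical-next i k (h ∷ hs) = begin
  occurrences verticalEdges (suc i , i + suc k) (columnsFrom (suc i) (h ∷ hs))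
    ≡⟨ cong (λ y → occurrences verticalEdges (suc i , y) (columnsFrom (suc i) (h ∷ hs))) (+-suc i k) ⟩
  occurrences verticalEdges (suc i , suc i + k) (column (suc i) h ++ columnsFrom (suc (suc i)) hs)
    ≡⟨ occurrences-++ verticalEdges _ (column (suc i) h) _ ⟩
  occurrences verticalEdges (suc i , suc i + k) (column (suc i) h) + occurrences verticalEdges (suc i , suc i + k) (columnsFrom (suc (suc i)) hs)
    ≡⟨ cong₂ _+_ (vertical-own (suc i) (suc i) k h (λ _ → here refl))
                 (occurrences-later verticalEdges vertical-not-left (suc i) _ (suc (suc i)) hs ≤-refl) ⟩
  ι (k <? h) + 0
    ≡⟨ +-identityʳ _ ⟩
  ι (k <? h) ∎
  where open ≡-Reasoning

vertical-next-below : ∀ i hs → occurrences verticalEdges (suc i , i + 0) (columnsFrom (suc i) hs) ≡ 0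
vertical-next-below i []       = refl
vertical-next-below i (h ∷ hs) =
  trans (occurrences-++ verticalEdges _ (column (suc i) h) _)
    (cong₂ _+_ (occurrences-none verticalEdges (suc i , i + 0) (suc i) h below)
               (occurrences-later verticalEdges vertical-not-left (suc i) _ (suc (suc i)) hs ≤-refl))
  where
  below : ∀ k → ¬ ((suc i , i + 0) ∈ verticalEdges (suc i , suc i + k))
  below k e∈ with +-cancelˡ-≡ i 0 (suc k) (trans (vertical-row (suc i , suc i + k) e∈) (sym (+-suc i k)))
  ... | ()

-- p is the height of column i, to the left of those counted.
vertical-columns : ∀ O i p hs → All (1 ≤_) hs →
  (∀ x y → i < x → O (x , y) ≡ occurrences verticalEdges (x , y) (column i p) +
                               occurrences verticalEdges (x , y) (columnsFrom (suc i) hs)) →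
  boundaryCount O (concatMap verticalEdges (columnsFrom (suc i) hs)) ≡ leftEdges p hs + rightEdges hs
vertical-columns O i p []             _          O≡ = refl
vertical-columns O i p (h@(suc h₀) ∷ hs) (_ ∷ 1≤hs) O≡ = begin
  boundaryCount O (concatMap verticalEdges (column (suc i) h ++ columnsFrom (suc (suc i)) hs))
    ≡⟨ boundaryCount-++ verticalEdges O (column (suc i) h) (columnsFrom (suc (suc i)) hs) ⟩
  boundaryCount O (concatMap verticalEdges (column (suc i) h)) + boundaryCount O (concatMap verticalEdges (columnsFrom (suc (suc i)) hs))
    ≡⟨ cong₂ _+_ (boundaryCount-column O (λ c → c) (λ c → suc (proj₁ c) , proj₂ c) (suc i) h)
                 (vertical-columns O (suc i) h hs 1≤hs later) ⟩
  (∑< h left? + ∑< h right?) + (leftEdges h hs + rightEdges hs)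
    ≡⟨ cong (_+ (leftEdges h hs + rightEdges hs)) (cong₂ _+_ lefts rights) ⟩
  ((h ∸ (p ∸ 1)) + suc (h ∸ suc (head₀ hs))) + (leftEdges h hs + rightEdges hs)
    ≡⟨ +-interchange (h ∸ (p ∸ 1)) _ (leftEdges h hs) _ ⟩
  leftEdges p (h ∷ hs) + rightEdges (h ∷ hs) ∎
  where
  open ≡-Reasoning
  occ = occurrences verticalEdges
  left? right? : ℕ → ℕ
  left?  k = ι (O (suc i , suc i + k) ≟ 1)
  right? k = ι (O (suc (suc i) , suc i + k) ≟ 1)
  split : ∀ x y → i < x → O (x , y) ≡ occ (x , y) (column i p) +
            (occ (x , y) (column (suc i) h) + occ (x , y) (columnsFrom (suc (suc i)) hs))
  split x y i<x = trans (O≡ x y i<x)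
    (cong (occ (x , y) (column i p) +_) (occurrences-++ verticalEdges (x , y) (column (suc i) h) _))
  later : ∀ x y → suc i < x → O (x , y) ≡ occ (x , y) (column (suc i) h) + occ (x , y) (columnsFrom (suc (suc i)) hs)
  later x y i<x = trans (split x y (<⇒≤ i<x))
    (cong (_+ (occ (x , y) (column (suc i) h) + occ (x , y) (columnsFrom (suc (suc i)) hs)))
      (occurrences-none verticalEdges (x , y) i p (λ k → vertical-not-right (i , i + k) i<x)))
  left : ∀ k → k < h → O (suc i , suc i + k) ≡ suc (ι (suc k <? p))
  left k k<h = begin
    O (suc i , suc i + k)
      ≡⟨ split (suc i) (suc i + k) ≤-refl ⟩
    occ (suc i , suc i + k) (column i p) + (occ (suc i , suc i + k) (column (suc i) h) + occ (suc i , suc i + k) (columnsFrom (suc (suc i)) hs))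
      ≡⟨ cong₂ _+_
           -- Row `suc i + k` has offset `suc k` in column `i`, which starts one row lower.
           (trans (cong (λ y → occ (suc i , y) (column i p)) (sym (+-suc i k)))
                  (vertical-own (suc i) i (suc k) p (λ _ → there (here refl))))
           (cong₂ _+_ (trans (vertical-own (suc i) (suc i) k h (λ _ → here refl)) (ι-yes (k <? h) k<h))
                      (occurrences-later verticalEdges vertical-not-left (suc i) _ (suc (suc i)) hs ≤-refl)) ⟩
    ι (suc k <? p) + 1
      ≡⟨ +-comm (ι (suc k <? p)) 1 ⟩
    suc (ι (suc k <? p)) ∎
  left-threshold : ∀ p → ∑< h (λ k → ι (suc (ι (suc k <? p)) ≟ 1)) ≡ h ∸ (p ∸ 1)
  left-threshold zero    = ∑<-threshold h 0
  left-threshold (suc p) = ∑<-threshold h p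
  lefts : ∑< h left? ≡ h ∸ (p ∸ 1)
  lefts = trans (∑<-cong h (λ k k<h → cong (λ x → ι (x ≟ 1)) (left k k<h))) (left-threshold p)
  right : ∀ k → k < h → O (suc (suc i) , suc i + k) ≡
                        suc (occ (suc (suc i) , suc i + k) (columnsFrom (suc (suc i)) hs))
  right k k<h = trans (later (suc (suc i)) (suc i + k) ≤-refl)
    (cong (_+ _) (trans (vertical-own (suc (suc i)) (suc i) k h (λ _ → there (here refl))) (ι-yes (k <? h) k<h)))
  rights : ∑< h right? ≡ suc (h ∸ suc (head₀ hs))
  rights = cong₂ _+_
    (cong (λ x → ι (x ≟ 1)) (trans (right 0 (s≤s z≤n)) (cong suc (vertical-next-below (suc i) hs))))
    (trans (∑<-cong h₀ (λ k k<h₀ → cong (λ x → ι (x ≟ 1))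
             (trans (right (suc k) (s≤s k<h₀)) (cong suc (vertical-next (suc i) k hs)))))
           (∑<-threshold h₀ (head₀ hs)))

-- Both sides are the maximum of `m` and `n`.
m∸n+n≡m+[n∸m] : ∀ m n → m ∸ n + n ≡ m + (n ∸ m)
m∸n+n≡m+[n∸m] zero    n       = cong (_+ n) (0∸n≡0 n)
m∸n+n≡m+[n∸m] (suc m) zero    = refl
m∸n+n≡m+[n∸m] (suc m) (suc n) = trans (+-suc (m ∸ n) n) (cong suc (m∸n+n≡m+[n∸m] m n))

-- The right-hand side is `leftEdges 0 (h ∷ hs)`. Between neighbouring columns a descent seen from
-- the right is exchanged for an ascent seen from the left.
rightEdges≡ : ∀ h hs → All (1 ≤_) (h ∷ hs) → rightEdges (h ∷ hs) ≡ h + leftEdges h hs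
rightEdges≡ (suc h) []        _                 = refl
rightEdges≡ zero    _         (() ∷ _)
rightEdges≡ (suc h) (h′ ∷ hs) (_ ∷ 1≤h′ ∷ 1≤hs) = begin
  suc (h ∸ h′) + rightEdges (h′ ∷ hs)             ≡⟨ cong (suc (h ∸ h′) +_) (rightEdges≡ h′ hs (1≤h′ ∷ 1≤hs)) ⟩
  suc (h ∸ h′) + (h′ + leftEdges h′ hs)           ≡⟨ +-assoc (suc (h ∸ h′)) h′ _ ⟨
  suc (h ∸ h′ + h′) + leftEdges h′ hs             ≡⟨ cong (λ x → suc x + leftEdges h′ hs) (m∸n+n≡m+[n∸m] h h′) ⟩
  suc (h + (h′ ∸ h)) + leftEdges h′ hs            ≡⟨ +-assoc (suc h) (h′ ∸ h) _ ⟩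
  suc h + ((h′ ∸ h) + leftEdges h′ hs)            ∎
  where
  open ≡-Reasoning

heights-positive : ∀ {hs} → IsHeightSequence hs → All (1 ≤_) hs
heights-positive (final 1≤h) = 1≤h ∷ []
heights-positive (2≤h ∷ hs)  = <⇒≤ 2≤h ∷ heights-positive hs

horizontal-boundary : ∀ P → length (boundary horizontalEdges (cells P)) ≡ 2 * length (heights P)
horizontal-boundary P@(hs , valid) =
  horizontal-columns (λ e → occurrences horizontalEdges e (cells P)) 1 hs (heights-positive valid) (λ _ _ _ → refl)

vertical-boundary : ∀ P → length (boundary verticalEdges (cells P)) ≡ 2 * leftEdges 0 (heights P)
vertical-boundary P@(hs , valid) =
  -- An empty column `0` serves as left neighbour of the first column.
  trans (vertical-columns (λ e → occurrences verticalEdges e (cells P)) 0 0 hs (heights-positive valid) (λ _ _ _ → refl))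
    (cong (leftEdges 0 hs +_) (trans (edges≡ hs valid) (sym (+-identityʳ _))))
  where
  edges≡ : ∀ hs → IsHeightSequence hs → rightEdges hs ≡ leftEdges 0 hs
  edges≡ (h ∷ hs) valid = rightEdges≡ h hs (heights-positive valid)

-- Counting polyominoes

-- The two shapes of a height sequence over an unrestricted list: all heights at least two (for a
-- nonempty list), or a final height of one after such heights.
raise raise₁ : List ℕ → List ℕ
raise  = map (2 +_)
raise₁ ks = raise ks ++ 1 ∷ []

raise-valid : ∀ k ks → IsHeightSequence (raise (k ∷ ks))
raise-valid k []        = final (s≤s z≤n)
raise-valid k (k′ ∷ ks) = s≤s (s≤s z≤n) ∷ raise-valid k′ ks

raise₁-valid : ∀ ks → IsHeightSequence (raise₁ ks)
raise₁-valid []            = final (s≤s z≤n)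
raise₁-valid (k ∷ [])      = s≤s (s≤s z≤n) ∷ raise₁-valid []
raise₁-valid (k ∷ k′ ∷ ks) = s≤s (s≤s z≤n) ∷ raise₁-valid (k′ ∷ ks)

lower : ∀ {hs} → IsHeightSequence hs → (∃[ k ] ∃[ ks ] hs ≡ raise (k ∷ ks)) ⊎ (∃[ ks ] hs ≡ raise₁ ks)
lower (final {suc zero}    _) = inj₂ ([] , refl)
lower (final {suc (suc k)} _) = inj₁ (k , [] , refl)
lower (s≤s (s≤s {n = k} _) ∷ hs) with lower hs
... | inj₁ (k′ , ks , eq) = inj₁ (k , k′ ∷ ks , cong (suc (suc k) ∷_) eq)
... | inj₂ (ks , eq)      = inj₂ (k ∷ ks , cong (suc (suc k) ∷_) eq)

raise-injective : ∀ {ks ks′} → raise ks ≡ raise ks′ → ks ≡ ks′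
raise-injective = map-injective (λ { refl → refl })

raise₁-injective : ∀ {ks ks′} → raise₁ ks ≡ raise₁ ks′ → ks ≡ ks′
raise₁-injective {ks} {ks′} eq = raise-injective (++-cancelʳ (1 ∷ []) (raise ks) (raise ks′) eq)

raise≢raise₁ : ∀ ks ks′ → ¬ (raise ks ≡ raise₁ ks′)
raise≢raise₁ []       []         ()
raise≢raise₁ []       (k′ ∷ ks′) ()
raise≢raise₁ (k ∷ ks) []         ()
raise≢raise₁ (k ∷ ks) (k′ ∷ ks′) eq = raise≢raise₁ ks ks′ (proj₂ (∷-injective eq))

leftEdges-raise : ∀ p ks → leftEdges (2 + p) (raise ks) ≡ rises p ks
leftEdges-raise p []       = refl
leftEdges-raise p (k ∷ ks) = cong ((suc k ∸ p) +_) (leftEdges-raise k ks)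

-- The single cell of the last column is covered on its left, as the column before it has height at
-- least two.
leftEdges-raise₁ : ∀ p ks → leftEdges (2 + p) (raise₁ ks) ≡ rises p ks
leftEdges-raise₁ p []       = trans (+-identityʳ (0 ∸ p)) (0∸n≡0 p)
leftEdges-raise₁ p (k ∷ ks) = cong ((suc k ∸ p) +_) (leftEdges-raise₁ k ks)

lminFrom-raise : ∀ μ ks → lminFrom (2 + μ) (raise ks) ≡ lminFrom μ ks
lminFrom-raise μ []       = refl
lminFrom-raise μ (k ∷ ks) = cong (_ +_) (lminFrom-raise _ ks)

-- The final height one is below all raised heights and thus one more minimum.
lminFrom-raise₁ : ∀ μ ks → lminFrom (2 + μ) (raise₁ ks) ≡ suc (lminFrom μ ks)
lminFrom-raise₁ μ []       = refl
lminFrom-raise₁ μ (k ∷ ks) = trans (cong (_ +_) (lminFrom-raise₁ _ ks)) (+-suc _ _)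

IsHeightSequence-irrelevant : ∀ {hs} → Irrelevant (IsHeightSequence hs)
IsHeightSequence-irrelevant (final p)  (final q)  = cong final (≤-irrelevant p q)
IsHeightSequence-irrelevant (p ∷ hs) (q ∷ hs′) = cong₂ _∷_ (≤-irrelevant p q) (IsHeightSequence-irrelevant hs hs′)

polyomino-≡ : ∀ m n {P Q : 𝓕 m n} → heights (proj₁ P) ≡ heights (proj₁ Q) → P ≡ Q
polyomino-≡ m n eq = subset-≡ (×-irrelevant ≡-irrelevant ≡-irrelevant) (subset-≡ IsHeightSequence-irrelevant eq)

Realises : FibonacciPolyomino → ℕ → ℕ → ℕ → Set
Realises P m n j = length (heights P) ≡ m × leftEdges 0 (heights P) ≡ n × lmin P ≡ j

Polyominoes : ℕ → ℕ → ℕ → Set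
Polyominoes m n j = Σ[ P ∈ 𝓕 m n ] lmin (proj₁ P) ≡ j

realise : ∀ {m n j} P → Realises P m n j → Polyominoes m n j
realise P (len , left , lm) =
  (P , trans (horizontal-boundary P) (cong (2 *_) len) , trans (vertical-boundary P) (cong (2 *_) left)) , lm

realised : ∀ m n {j} (P : Polyominoes m n j) → Realises (proj₁ (proj₁ P)) m n j
realised m n ((P , hor , ver) , lm) =
  *-cancelˡ-≡ _ _ 2 (trans (sym (horizontal-boundary P)) hor) ,
  *-cancelˡ-≡ _ _ 2 (trans (sym (vertical-boundary P)) ver) , lm

injective∧surjective⇒↔ : ∀ {X Y : Set} (f : X → Y) → (∀ {x x′} → f x ≡ f x′ → x ≡ x′) →
                         (∀ y → ∃[ x ] f x ≡ y) → Y ↔ X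
injective∧surjective⇒↔ f inj surj =
  mk↔ₛ′ (proj₁ ∘ surj) f (λ x → inj (proj₂ (surj (f x)))) (proj₂ ∘ surj)

Sequences : ℕ → ℕ → ℕ → Set
Sequences m w j = Σ[ ks ∈ List ℕ ] length ks ≡ m × rises 0 ks ≡ w × lminHeights ks ≡ j

sequences↔forests : ∀ m w j → Sequences m w j ↔ Forests m w j
sequences↔forests m w j = injective∧surjective⇒↔ sequence sequence-injective sequence-surjective
  where
  sequence : Forests m w j → Sequences m w j
  sequence (f , sz , wt , rt) =
    decode 0 f , trans (length-decode 0 f) sz , trans (rises₀-decode f) wt , trans (lminHeights-decode f) rt
  sequence-injective : ∀ {f f′} → sequence f ≡ sequence f′ → f ≡ f′
  sequence-injective eq = subset-≡ 3≡-irrelevant (decode-injective _ _ _ refl (sym (cong proj₁ eq)))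
  sequence-surjective : ∀ ks → ∃[ f ] sequence f ≡ ks
  sequence-surjective (ks , len , rs , lm) with decode-surjective ks
  ... | f , refl = (f , trans (sym (length-decode 0 f)) len , trans (sym (rises₀-decode f)) rs ,
                        trans (sym (lminHeights-decode f)) lm) , subset-≡ 3≡-irrelevant refl

module _ (k : ℕ) (ks : List ℕ) where

  leftEdges₀-raise : leftEdges 0 (raise (k ∷ ks)) ≡ suc (rises 0 (k ∷ ks))
  leftEdges₀-raise = cong (2 + k +_) (leftEdges-raise k ks)

  leftEdges₀-raise₁ : leftEdges 0 (raise₁ (k ∷ ks)) ≡ suc (rises 0 (k ∷ ks))
  leftEdges₀-raise₁ = cong (2 + k +_) (leftEdges-raise₁ k ks)

  lminHeights-raise : lminHeights (raise (k ∷ ks)) ≡ lminHeights (k ∷ ks)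
  lminHeights-raise = cong suc (lminFrom-raise k ks)

  lminHeights-raise₁ : lminHeights (raise₁ (k ∷ ks)) ≡ suc (lminHeights (k ∷ ks))
  lminHeights-raise₁ = cong suc (lminFrom-raise₁ k ks)

length-raise₁ : ∀ ks → length (raise₁ ks) ≡ suc (length ks)
length-raise₁ ks = trans (length-++ (raise ks)) (trans (+-comm _ 1) (cong suc (length-map (2 +_) ks)))

-- The summands differ in whether the last height exceeds one. Dropping a final one removes a column
-- and a minimum; in both cases the total rise is one less than the vertical semiperimeter.
polyominoes↔sequences : ∀ m n j → Polyominoes (2 + m) (2 + n) (suc j) ↔
                                  (Sequences (2 + m) (suc n) (suc j) ⊎ Sequences (suc m) (suc n) j)
polyominoes↔sequences m n j = injective∧surjective⇒↔ build build-injective build-surjective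
  where
  build : Sequences (2 + m) (suc n) (suc j) ⊎ Sequences (suc m) (suc n) j → Polyominoes (2 + m) (2 + n) (suc j)
  build (inj₁ (k ∷ ks , len , rs , lm)) = realise (raise (k ∷ ks) , raise-valid k ks)
    (trans (length-map (2 +_) (k ∷ ks)) len , trans (leftEdges₀-raise k ks) (cong suc rs) , trans (lminHeights-raise k ks) lm)
  build (inj₂ (k ∷ ks , len , rs , lm)) = realise (raise₁ (k ∷ ks) , raise₁-valid (k ∷ ks))
    (trans (length-raise₁ (k ∷ ks)) (cong suc len) , trans (leftEdges₀-raise₁ k ks) (cong suc rs) ,
     trans (lminHeights-raise₁ k ks) (cong suc lm))

  heightsOf : Polyominoes (2 + m) (2 + n) (suc j) → List ℕ
  heightsOf P = heights (proj₁ (proj₁ P))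

  build-injective : ∀ {x y} → build x ≡ build y → x ≡ y
  build-injective {inj₁ (k ∷ ks , _)} {inj₁ (k′ ∷ ks′ , _)} eq =
    cong inj₁ (subset-≡ 3≡-irrelevant (raise-injective (cong heightsOf eq)))
  build-injective {inj₁ (k ∷ ks , _)} {inj₂ (k′ ∷ ks′ , _)} eq =
    ⊥-elim (raise≢raise₁ (k ∷ ks) (k′ ∷ ks′) (cong heightsOf eq))
  build-injective {inj₂ (k ∷ ks , _)} {inj₁ (k′ ∷ ks′ , _)} eq =
    ⊥-elim (raise≢raise₁ (k′ ∷ ks′) (k ∷ ks) (sym (cong heightsOf eq)))
  build-injective {inj₂ (k ∷ ks , _)} {inj₂ (k′ ∷ ks′ , _)} eq =
    cong inj₂ (subset-≡ 3≡-irrelevant (raise₁-injective (cong heightsOf eq)))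

  build-surjective : ∀ P → ∃[ x ] build x ≡ P
  build-surjective P@(((hs , valid) , _) , _) with lower valid | realised (2 + m) (2 + n) P
  ... | inj₁ (k , ks , refl) | len , left , lm =
    inj₁ (k ∷ ks , trans (sym (length-map (2 +_) (k ∷ ks))) len ,
          suc-injective (trans (sym (leftEdges₀-raise k ks)) left) , trans (sym (lminHeights-raise k ks)) lm) ,
    subset-≡ ≡-irrelevant (polyomino-≡ (2 + m) (2 + n) refl)
  -- The single cell has only one column.
  ... | inj₂ ([] , refl) | () , _
  ... | inj₂ (k ∷ ks , refl) | len , left , lm =
    inj₂ (k ∷ ks , suc-injective (trans (sym (length-raise₁ (k ∷ ks))) len) ,
          suc-injective (trans (sym (leftEdges₀-raise₁ k ks)) left) ,
          suc-injective (trans (sym (lminHeights-raise₁ k ks)) lm)) ,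
    subset-≡ ≡-irrelevant (polyomino-≡ (2 + m) (2 + n) refl)

polyominoes-count : ∀ m n j → Polyominoes (2 + m) (2 + n) (suc j) ↔
                    Fin (B (2 + m) (suc j) * (n C suc m) + B (suc m) j * (n C m))
polyominoes-count m n j = ⊎↔Fin (polyominoes↔sequences m n j)
  (forests-count (2 + m) (suc n) (suc j) ↔-∘ sequences↔forests (2 + m) (suc n) (suc j))
  (forests-count (suc m) (suc n) j ↔-∘ sequences↔forests (suc m) (suc n) j)
  -- `compositions (suc n)` computes to the binomials at `2 + m` and `suc m` parts.
  refl

single-column : ∀ n → 1 ≤ n → Polyominoes 1 n 1
single-column n 1≤n = realise (n ∷ [] , final 1≤n) (refl , +-identityʳ n , refl)

single-column-heights : ∀ {n} hs → length hs ≡ 1 → leftEdges 0 hs ≡ n → hs ≡ n ∷ []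
single-column-heights (h ∷ []) _ left = cong (_∷ []) (trans (sym (+-identityʳ h)) left)

single-column-unique : ∀ n (Q : 𝓕 1 n) → heights (proj₁ Q) ≡ n ∷ []
single-column-unique n Q =
  let len , left , _ = realised 1 n (Q , refl) in single-column-heights (heights (proj₁ Q)) len left

corollary4p3 : (∀ (m n j : ℕ) → 2 ≤ m → 2 ≤ n → 1 ≤ j →
    (Σ[ P ∈ 𝓕 m n ] lmin (proj₁ P) ≡ j)
    ↔ Fin (B m j * ((n ∸ 2) C (m ∸ 1)) + B (m ∸ 1) (j ∸ 1) * ((n ∸ 2) C (m ∸ 2))))
    × (∀ (n : ℕ) → 1 ≤ n →
    Σ[ P ∈ 𝓕 1 n ] ((Q : 𝓕 1 n) → Q ≡ P) × lmin (proj₁ P) ≡ 1)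
corollary4p3 =
  (λ { (suc (suc m)) (suc (suc n)) (suc j) (s≤s (s≤s _)) (s≤s (s≤s _)) (s≤s _) → polyominoes-count m n j }) ,
  (λ n 1≤n → let P , lm = single-column n 1≤n in P , (λ Q → polyomino-≡ 1 n (single-column-unique n Q)) , lm)
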